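{- Let $\kappa<\kappa'$ be regular cardinals. Then the inclusion functor $\mathbf{CAMA}_{\kappa'}\hookrightarrow\mathbf{CAMA}_\kappa$ and the inclusion functor $\mathbf{MKF}_{\kappa'}\hookrightarrow\mathbf{MKF}_\kappa$ are not essentially surjective; i.e. there is an object of $\mathbf{CAMA}_\kappa$ not isomorphic to any object of $\mathbf{CAMA}_{\kappa'}$, and an object of $\mathbf{MKF}_\kappa$ not isomorphic to any object of $\mathbf{MKF}_{\kappa'}$.
   Context: A modal algebra is a Boolean algebra with a unary operation $\Diamond$ satisfying $\Diamond 0=0$ and $\Diamond(x\vee y)=\Diamond x\vee\Diamond y$; complete/atomic refer to the Boolean reduct; for a cardinal $\lambda$ it is $\lambda$-additive if $\Diamond\bigvee X=\bigvee_{x\in X}\Diamond x$ for every $X$ with $|X|<\lambda$. A homomorphism of complete modal algebras is a Boolean homomorphism preserving all joins and meets and commuting with $\Diamond$. $\mathbf{CAMA}_\lambda$ is the category of $\lambda$-additive complete atomic modal algebras with these homomorphisms. A multi-relational Kripke frame is a pair $\langle W,S\rangle$ with $W$ non-empty and $S$ a non-empty set of binary relations on $W$; it is $\lambda$-downward directed if for every $S'\subseteq S$ with $|S'|<\lambda$ there is $R\in S$ with $R\subseteq\bigcap S'$ (with $\bigcap\emptyset=W\times W$). A homomorphism $f:\langle W_1,S_1\rangle\to\langle W_2,S_2\rangle$ is a map $f:W_1\to W_2$ such that: (i) for every $x\in W_1$ and $R_2\in S_2$ there is $R_1\in S_1$ such that for all $y\in W_1$, $xR_1y$ implies $f(x)R_2f(y)$;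 (ii) for every $x\in W_1$ and $R_1\in S_1$ there is $R_2\in S_2$ such that for all $u\in W_2$, if $f(x)R_2u$ then there exists $y\in W_1$ with $xR_1y$ and $f(y)=u$; an isomorphism is a bijective homomorphism. $\mathbf{MKF}_\lambda$ is the category of $\lambda$-downward directed multi-relational Kripke frames with these homomorphisms. A functor is essentially surjective if every object of the target is isomorphic to the image of some object. -}

module Defs where

open import Algebra.Lattice.Bundles using (BooleanAlgebra)
import Algebra.Lattice.Properties.Lattice as LatticeProperties
open import Algebra.Lattice.Morphism.Structures using (module LatticeMorphisms)
open import Data.Nat.Base using (ℕ)
open import Data.Product.Base using (Σ; Σ-syntax; ∃; ∃-syntax; _×_; _,_; proj₁; proj₂)
open import Data.Sum.Base using (_⊎_)
open import Function.Base using (id; _∘_)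
open import Function.Bundles using (Injection)
open import Function.Definitions using (Congruent; Bijective)
open import Induction.WellFounded using (WellFounded)
open import Level using (Level; suc; _⊔_)
open import Relation.Binary.Bundles using (Setoid; Poset)
open import Relation.Binary.Core using (Rel; _⇒_; _⇔_)
import Relation.Binary.Construct.On as On
open import Relation.Binary.PropositionalEquality
  using (_≡_; refl; sym; trans; cong; subst; _≗_)
  renaming (setoid to ≡-setoid)
open import Relation.Binary.Structures using (IsStrictTotalOrder; IsEquivalence)
open import Relation.Nullary.Negation.Core using (¬_)
open import Relation.Unary using (Pred; _∈_; _⊆_)

private
  variable
    a b ℓ o h e o′ h′ e′ : Level

------------------------------------------------------------------------
-- Cardinals

record WellOrder ℓ : Set (suc ℓ) where
  infix 4 _<_
  field
    Carrier            : Set ℓ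
    _<_                : Rel Carrier ℓ
    isStrictTotalOrder : IsStrictTotalOrder _≡_ _<_
    wellFounded        : WellFounded _<_

  underlying : Setoid ℓ ℓ
  underlying = ≡-setoid Carrier

-- X injects into a proper initial segment of the well-order L.  When L is
-- an initial ordinal this says that the cardinality of X is less than L.

∣_∣<_ : Setoid a b → WellOrder ℓ → Set (a ⊔ b ⊔ ℓ)
∣ X ∣< L = Σ[ α ∈ L.Carrier ] Σ[ f ∈ Injection X L.underlying ]
             (∀ x → Injection.to f x L.< α)
  where module L = WellOrder L

-- A cardinal is an initial ordinal: it does not inject into any of its
-- proper initial segments.

record Cardinal ℓ : Set (suc ℓ) where
  field
    wellOrder : WellOrder ℓ

  open WellOrder wellOrder public

  field
    initial : ¬ (∣ underlying ∣< wellOrder)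

infix 4 _<ᶜ_
_<ᶜ_ : Cardinal ℓ → Cardinal ℓ → Set ℓ
κ <ᶜ κ′ = ∣ Cardinal.underlying κ ∣< Cardinal.wellOrder κ′

-- Infinite, and no function from a smaller ordinal is cofinal.  As the
-- carrier is inhabited, functions on the initial segment below α are given
-- as restrictions of functions on the whole carrier.

record Regular (κ : Cardinal ℓ) : Set ℓ where
  open Cardinal κ
  field
    infinite : Injection (≡-setoid ℕ) underlying
    bounded  : ∀ (α : Carrier) (f : Carrier → Carrier) →
               ∃[ γ ] (∀ β → β < α → f β < γ)

-- A subset of a setoid, with the inherited equality.  A predicate is not
-- required to respect that equality; the subset it denotes is its closure
-- under it, which has the same cardinality.

subset : (X : Setoid a b) → Pred (Setoid.Carrier X) ℓ → Setoid (a ⊔ ℓ) b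
subset X P = On.setoid X (proj₁ {B = P})

∣∣<-mono : (κ κ′ : Cardinal ℓ) → κ <ᶜ κ′ → (X : Setoid a b) →
           ∣ X ∣< Cardinal.wellOrder κ → ∣ X ∣< Cardinal.wellOrder κ′
∣∣<-mono κ κ′ (α′ , g , g<α′) X (_ , f , _) = α′ , record
  { to        = G.to ∘ F.to
  ; cong      = G.cong ∘ F.cong
  ; injective = F.injective ∘ G.injective
  } , g<α′ ∘ F.to
  where
  module F = Injection f
  module G = Injection g

------------------------------------------------------------------------
-- Categories

record Category o h e : Set (suc (o ⊔ h ⊔ e)) where
  infix  4 _≋_
  infixr 9 _⊙_
  field
    Obj   : Set o
    Hom   : Obj → Obj → Set h
    _≋_   : ∀ {A B} → Rel (Hom A B) e
    idₘ   : ∀ {A} → Hom A A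
    _⊙_   : ∀ {A B C} → Hom B C → Hom A B → Hom A C
    equiv : ∀ {A B} → IsEquivalence (_≋_ {A} {B})
    identityˡ : ∀ {A B} {f : Hom A B} → idₘ ⊙ f ≋ f
    identityʳ : ∀ {A B} {f : Hom A B} → f ⊙ idₘ ≋ f
    assoc     : ∀ {A B C D} {f : Hom A B} {g : Hom B C} {k : Hom C D} →
                (k ⊙ g) ⊙ f ≋ k ⊙ (g ⊙ f)
    ⊙-resp-≋  : ∀ {A B C} {f f′ : Hom B C} {g g′ : Hom A B} →
                f ≋ f′ → g ≋ g′ → f ⊙ g ≋ f′ ⊙ g′

  infix 4 _≅_
  record _≅_ (A B : Obj) : Set (h ⊔ e) where
    field
      to   : Hom A B
      from : Hom B A
      isoˡ : from ⊙ to ≋ idₘ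
      isoʳ : to ⊙ from ≋ idₘ

record Functor (C : Category o h e) (D : Category o′ h′ e′)
       : Set (o ⊔ h ⊔ e ⊔ o′ ⊔ h′ ⊔ e′) where
  private
    module C = Category C
    module D = Category D
  field
    F₀       : C.Obj → D.Obj
    F₁       : ∀ {A B} → C.Hom A B → D.Hom (F₀ A) (F₀ B)
    F-id     : ∀ {A} → F₁ (C.idₘ {A}) D.≋ D.idₘ
    F-⊙      : ∀ {A B C} {f : C.Hom A B} {g : C.Hom B C} →
               F₁ (g C.⊙ f) D.≋ F₁ g D.⊙ F₁ f
    F-resp-≋ : ∀ {A B} {f g : C.Hom A B} → f C.≋ g → F₁ f D.≋ F₁ g

EssentiallySurjective : {C : Category o h e} {D : Category o′ h′ e′} →
                        Functor C D → Set _
EssentiallySurjective {C = C} {D = D} F =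
  ∀ (B : Category.Obj D) → Σ[ A ∈ Category.Obj C ] (F₀ A ≅ B)
  where
  open Functor F
  open Category D using (_≅_)

FullSubcategory : (C : Category o h e) → Pred (Category.Obj C) ℓ →
                  Category (o ⊔ ℓ) h e
FullSubcategory C P = record
  { Obj       = Σ Obj P
  ; Hom       = λ A B → Hom (proj₁ A) (proj₁ B)
  ; _≋_       = _≋_
  ; idₘ       = idₘ
  ; _⊙_       = _⊙_
  ; equiv     = equiv
  ; identityˡ = identityˡ
  ; identityʳ = identityʳ
  ; assoc     = assoc
  ; ⊙-resp-≋  = ⊙-resp-≋
  } where open Category C

inclusion : (C : Category o h e) {P Q : Pred (Category.Obj C) ℓ} → P ⊆ Q →
            Functor (FullSubcategory C P) (FullSubcategory C Q)
inclusion C P⊆Q = record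
  { F₀       = λ (A , p) → A , P⊆Q p
  ; F₁       = id
  ; F-id     = IsEquivalence.refl equiv
  ; F-⊙      = IsEquivalence.refl equiv
  ; F-resp-≋ = id
  } where open Category C

------------------------------------------------------------------------
-- Complete atomic modal algebras

-- Subsets are predicates valued in Set ℓ, ℓ being the level of the
-- algebra; under excluded middle every predicate is equivalent to one.

module _ (B : BooleanAlgebra ℓ ℓ) where
  open BooleanAlgebra B
  open Poset (LatticeProperties.poset lattice) using (_≤_)

  IsJoin : Pred Carrier ℓ → Carrier → Set ℓ
  IsJoin X s = (∀ x → x ∈ X → x ≤ s) × (∀ u → (∀ x → x ∈ X → x ≤ u) → s ≤ u)

  IsMeet : Pred Carrier ℓ → Carrier → Set ℓ
  IsMeet X m = (∀ x → x ∈ X → m ≤ x) × (∀ l → (∀ x → x ∈ X → l ≤ x) → l ≤ m)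

  IsAtom : Carrier → Set ℓ
  IsAtom p = p ≉ ⊥ × (∀ x → x ≤ p → x ≈ ⊥ ⊎ x ≈ p)

  IsAtomic : Set ℓ
  IsAtomic = ∀ x → x ≉ ⊥ → ∃[ p ] (IsAtom p × p ≤ x)

image : {A : Set a} (Y : Setoid ℓ ℓ) → (A → Setoid.Carrier Y) →
        Pred A ℓ → Pred (Setoid.Carrier Y) (a ⊔ ℓ)
image Y f X y = ∃[ x ] (x ∈ X × Setoid._≈_ Y y (f x))

record CompleteAtomicModalAlgebra ℓ : Set (suc ℓ) where
  field
    booleanAlgebra : BooleanAlgebra ℓ ℓ

  open BooleanAlgebra booleanAlgebra public

  field
    ⋁      : Pred Carrier ℓ → Carrier
    ⋀      : Pred Carrier ℓ → Carrier
    ⋁-join : ∀ X → IsJoin booleanAlgebra X (⋁ X)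
    ⋀-meet : ∀ X → IsMeet booleanAlgebra X (⋀ X)
    atomic : IsAtomic booleanAlgebra
    ◇      : Carrier → Carrier
    ◇-cong : Congruent _≈_ _≈_ ◇
    ◇-⊥    : ◇ ⊥ ≈ ⊥
    ◇-∨    : ∀ x y → ◇ (x ∨ y) ≈ ◇ x ∨ ◇ y

IsAdditive : Cardinal ℓ → Pred (CompleteAtomicModalAlgebra ℓ) (suc ℓ)
IsAdditive {ℓ} κ A = ∀ (X : Pred Carrier ℓ) →
  ∣ subset setoid X ∣< Cardinal.wellOrder κ →
  ◇ (⋁ X) ≈ ⋁ (image setoid ◇ X)
  where open CompleteAtomicModalAlgebra A

record AlgebraHom (A B : CompleteAtomicModalAlgebra ℓ) : Set (suc ℓ) where
  private
    module A = CompleteAtomicModalAlgebra A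
    module B = CompleteAtomicModalAlgebra B
  open LatticeMorphisms A.rawLattice B.rawLattice using (IsLatticeHomomorphism)
  field
    to      : A.Carrier → B.Carrier
    isLatticeHomomorphism : IsLatticeHomomorphism to
    ⊤-homo  : to A.⊤ B.≈ B.⊤
    ⊥-homo  : to A.⊥ B.≈ B.⊥
    ¬-homo  : ∀ x → to (A.¬ x) B.≈ B.¬ (to x)
    ⋁-homo  : ∀ X → to (A.⋁ X) B.≈ B.⋁ (image B.setoid to X)
    ⋀-homo  : ∀ X → to (A.⋀ X) B.≈ B.⋀ (image B.setoid to X)
    ◇-homo  : ∀ x → to (A.◇ x) B.≈ B.◇ (to x)

  open IsLatticeHomomorphism isLatticeHomomorphism public

module _ (A : CompleteAtomicModalAlgebra ℓ) where
  open CompleteAtomicModalAlgebra A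
  open Poset (LatticeProperties.poset lattice)
    using (_≤_; antisym; ≤-respʳ-≈; ≤-respˡ-≈)
    renaming (refl to ≤-refl; trans to ≤-trans)
  private
    module E = Setoid setoid

  ⋁-resp : ∀ {X Y} → (∀ x → x ∈ X → ∃[ y ] (y ∈ Y × x ≈ y)) →
           (∀ y → y ∈ Y → ∃[ x ] (x ∈ X × y ≈ x)) → ⋁ X ≈ ⋁ Y
  ⋁-resp {X} {Y} f g = antisym (half X Y f) (half Y X g)
    where
    half : ∀ X Y → (∀ x → x ∈ X → ∃[ y ] (y ∈ Y × x ≈ y)) → ⋁ X ≤ ⋁ Y
    half X Y f = proj₂ (⋁-join X) _ λ x x∈X → let y , y∈Y , x≈y = f x x∈X in
      ≤-respˡ-≈ (E.sym x≈y) (proj₁ (⋁-join Y) y y∈Y)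

  ⋀-resp : ∀ {X Y} → (∀ x → x ∈ X → ∃[ y ] (y ∈ Y × x ≈ y)) →
           (∀ y → y ∈ Y → ∃[ x ] (x ∈ X × y ≈ x)) → ⋀ X ≈ ⋀ Y
  ⋀-resp {X} {Y} f g = antisym (half X Y g) (half Y X f)
    where
    half : ∀ X Y → (∀ y → y ∈ Y → ∃[ x ] (x ∈ X × y ≈ x)) → ⋀ X ≤ ⋀ Y
    half X Y g = proj₂ (⋀-meet Y) _ λ y y∈Y → let x , x∈X , y≈x = g y y∈Y in
      ≤-respʳ-≈ (E.sym y≈x) (proj₁ (⋀-meet X) x x∈X)

idAlgebraHom : (A : CompleteAtomicModalAlgebra ℓ) → AlgebraHom A A
idAlgebraHom A = record
  { to     = id
  ; isLatticeHomomorphism = record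
    { isRelHomomorphism = record { cong = id }
    ; ∧-homo            = λ _ _ → E.refl
    ; ∨-homo            = λ _ _ → E.refl
    }
  ; ⊤-homo = E.refl
  ; ⊥-homo = E.refl
  ; ¬-homo = λ _ → E.refl
  ; ⋁-homo = λ X → ⋁-resp A (λ x p → x , (x , p , E.refl) , E.refl)
                            (λ y (x , p , q) → x , p , q)
  ; ⋀-homo = λ X → ⋀-resp A (λ x p → x , (x , p , E.refl) , E.refl)
                            (λ y (x , p , q) → x , p , q)
  ; ◇-homo = λ _ → E.refl
  } where module E = Setoid (CompleteAtomicModalAlgebra.setoid A)

composeAlgebraHom : {A B C : CompleteAtomicModalAlgebra ℓ} →
                    AlgebraHom B C → AlgebraHom A B → AlgebraHom A C
composeAlgebraHom {A = A} {B} {C} g f = record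
  { to     = G.to ∘ F.to
  ; isLatticeHomomorphism = record
    { isRelHomomorphism = record { cong = G.⟦⟧-cong ∘ F.⟦⟧-cong }
    ; ∧-homo            = λ x y → E.trans (G.⟦⟧-cong (F.∧-homo x y)) (G.∧-homo _ _)
    ; ∨-homo            = λ x y → E.trans (G.⟦⟧-cong (F.∨-homo x y)) (G.∨-homo _ _)
    }
  ; ⊤-homo = E.trans (G.⟦⟧-cong F.⊤-homo) G.⊤-homo
  ; ⊥-homo = E.trans (G.⟦⟧-cong F.⊥-homo) G.⊥-homo
  ; ¬-homo = λ x → E.trans (G.⟦⟧-cong (F.¬-homo x)) (G.¬-homo _)
  ; ⋁-homo = λ X → E.trans (G.⟦⟧-cong (F.⋁-homo X))
                  (E.trans (G.⋁-homo _) (⋁-resp C (⇒ X) (⇐ X)))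
  ; ⋀-homo = λ X → E.trans (G.⟦⟧-cong (F.⋀-homo X))
                  (E.trans (G.⋀-homo _) (⋀-resp C (⇒ X) (⇐ X)))
  ; ◇-homo = λ x → E.trans (G.⟦⟧-cong (F.◇-homo x)) (G.◇-homo _)
  }
  where
  module F = AlgebraHom f
  module G = AlgebraHom g
  module B = CompleteAtomicModalAlgebra B
  module C = CompleteAtomicModalAlgebra C
  module E = Setoid C.setoid

  ⇒ : ∀ X z → z ∈ image C.setoid G.to (image B.setoid F.to X) →
      ∃[ w ] (w ∈ image C.setoid (G.to ∘ F.to) X × z C.≈ w)
  ⇒ X z (y , (x , x∈X , y≈fx) , z≈gy) =
    z , (x , x∈X , E.trans z≈gy (G.⟦⟧-cong y≈fx)) , E.refl

  ⇐ : ∀ X z → z ∈ image C.setoid (G.to ∘ F.to) X →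
      ∃[ w ] (w ∈ image C.setoid G.to (image B.setoid F.to X) × z C.≈ w)
  ⇐ X z (x , x∈X , z≈gfx) =
    z , (F.to x , (x , x∈X , Setoid.refl B.setoid) , z≈gfx) , E.refl

CAMA-all : ∀ ℓ → Category (suc ℓ) (suc ℓ) ℓ
CAMA-all ℓ = record
  { Obj       = CompleteAtomicModalAlgebra ℓ
  ; Hom       = AlgebraHom
  ; _≋_       = λ {A} {B} f g → let open CompleteAtomicModalAlgebra B in
                  ∀ x → AlgebraHom.to f x ≈ AlgebraHom.to g x
  ; idₘ       = λ {A} → idAlgebraHom A
  ; _⊙_       = composeAlgebraHom
  ; equiv     = λ {A} {B} → let module E = Setoid (CompleteAtomicModalAlgebra.setoid B) in
                  record
                  { refl  = λ _ → E.refl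
                  ; sym   = λ p x → E.sym (p x)
                  ; trans = λ p q x → E.trans (p x) (q x)
                  }
  ; identityˡ = λ {A} {B} _ → Setoid.refl (CompleteAtomicModalAlgebra.setoid B)
  ; identityʳ = λ {A} {B} _ → Setoid.refl (CompleteAtomicModalAlgebra.setoid B)
  ; assoc     = λ {A} {B} {C} {D} _ → Setoid.refl (CompleteAtomicModalAlgebra.setoid D)
  ; ⊙-resp-≋  = λ {A} {B} {C} {f} {f′} {g} {g′} p q x →
                  Setoid.trans (CompleteAtomicModalAlgebra.setoid C)
                    (AlgebraHom.⟦⟧-cong f (q x)) (p (AlgebraHom.to g′ x))
  }

CAMA : Cardinal ℓ → Category (suc ℓ) (suc ℓ) ℓ
CAMA {ℓ} κ = FullSubcategory (CAMA-all ℓ) (IsAdditive κ)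

CAMA-inclusion : (κ κ′ : Cardinal ℓ) → κ <ᶜ κ′ → Functor (CAMA κ′) (CAMA κ)
CAMA-inclusion {ℓ} κ κ′ κ<κ′ = inclusion (CAMA-all ℓ)
  λ {A} additive X ∣X∣<κ → additive X
    (∣∣<-mono κ κ′ κ<κ′ (subset (CompleteAtomicModalAlgebra.setoid A) X) ∣X∣<κ)

------------------------------------------------------------------------
-- Multi-relational Kripke frames

-- Relations on W, two relations being equal when they have the same
-- extension.

relations : Set ℓ → Setoid (suc ℓ) ℓ
relations {ℓ} W = record
  { Carrier       = Rel W ℓ
  ; _≈_           = _⇔_
  ; isEquivalence = record
    { refl  = id , id
    ; sym   = λ (p , q) → q , p
    ; trans = λ (p , q) (p′ , q′) → (λ r → p′ (p r)) , (λ r → q (q′ r))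
    }
  }

record Frame ℓ : Set (suc ℓ) where
  field
    W          : Set ℓ
    S          : Pred (Rel W ℓ) ℓ
    W-nonempty : W
    S-nonempty : ∃[ R ] R ∈ S

⋂ : {W : Set ℓ} → Pred (Rel W ℓ) ℓ → Rel W (suc ℓ)
⋂ S x y = ∀ R → R ∈ S → R x y

IsDownwardDirected : Cardinal ℓ → Pred (Frame ℓ) (suc ℓ)
IsDownwardDirected {ℓ} κ F = ∀ (S′ : Pred (Rel W ℓ) ℓ) → S′ ⊆ S →
  ∣ subset (relations W) S′ ∣< Cardinal.wellOrder κ →
  ∃[ R ] (R ∈ S × R ⇒ ⋂ S′)
  where open Frame F

record FrameHom (F₁ F₂ : Frame ℓ) : Set (suc ℓ) where
  private
    module F₁ = Frame F₁
    module F₂ = Frame F₂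
  field
    to    : F₁.W → F₂.W
    forth : ∀ x R₂ → R₂ ∈ F₂.S →
            ∃[ R₁ ] (R₁ ∈ F₁.S × (∀ y → R₁ x y → R₂ (to x) (to y)))
    back  : ∀ x R₁ → R₁ ∈ F₁.S →
            ∃[ R₂ ] (R₂ ∈ F₂.S ×
                     (∀ u → R₂ (to x) u → ∃[ y ] (R₁ x y × to y ≡ u)))

idFrameHom : (F : Frame ℓ) → FrameHom F F
idFrameHom F = record
  { to    = id
  ; forth = λ x R R∈S → R , R∈S , λ y r → r
  ; back  = λ x R R∈S → R , R∈S , λ u r → u , r , refl
  }

composeFrameHom : {F G K : Frame ℓ} → FrameHom G K → FrameHom F G → FrameHom F K
composeFrameHom {F = F} {G} {K} g f = record
  { to    = G.to ∘ F.to
  ; forth = λ x R₃ R₃∈S →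
      let R₂ , R₂∈S , p = G.forth (F.to x) R₃ R₃∈S
          R₁ , R₁∈S , q = F.forth x R₂ R₂∈S
      in  R₁ , R₁∈S , λ y r → p (F.to y) (q y r)
  ; back  = λ x R₁ R₁∈S →
      let R₂ , R₂∈S , q = F.back x R₁ R₁∈S
          R₃ , R₃∈S , p = G.back (F.to x) R₂ R₂∈S
      in  R₃ , R₃∈S , λ u r →
            let v , s , gv≡u = p u r
                y , t , fy≡v = q v s
            in  y , t , trans (cong G.to fy≡v) gv≡u
  }
  where
  module F = FrameHom f
  module G = FrameHom g

MKF-all : ∀ ℓ → Category (suc ℓ) (suc ℓ) ℓ
MKF-all ℓ = record
  { Obj       = Frame ℓ
  ; Hom       = FrameHom
  ; _≋_       = λ f g → FrameHom.to f ≗ FrameHom.to g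
  ; idₘ       = λ {F} → idFrameHom F
  ; _⊙_       = composeFrameHom
  ; equiv     = record
    { refl  = λ _ → refl
    ; sym   = λ p x → sym (p x)
    ; trans = λ p q x → trans (p x) (q x)
    }
  ; identityˡ = λ _ → refl
  ; identityʳ = λ _ → refl
  ; assoc     = λ _ → refl
  ; ⊙-resp-≋  = λ {_} {_} {_} {f} {f′} {g} {g′} p q x →
                  trans (cong (FrameHom.to f) (q x)) (p (FrameHom.to g′ x))
  }

MKF : Cardinal ℓ → Category (suc ℓ) (suc ℓ) ℓ
MKF {ℓ} κ = FullSubcategory (MKF-all ℓ) (IsDownwardDirected κ)

MKF-inclusion : (κ κ′ : Cardinal ℓ) → κ <ᶜ κ′ → Functor (MKF κ′) (MKF κ)
MKF-inclusion {ℓ} κ κ′ κ<κ′ = inclusion (MKF-all ℓ)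
  λ {F} directed S′ S′⊆S ∣S′∣<κ → directed S′ S′⊆S
    (∣∣<-mono κ κ′ κ<κ′ (subset (relations (Frame.W F)) S′) ∣S′∣<κ)

-- Isomorphisms in the category of frames are the bijective homomorphisms.

IsFrameIsomorphism : {F G : Frame ℓ} → FrameHom F G → Set ℓ
IsFrameIsomorphism f = Bijective _≡_ _≡_ (FrameHom.to f)

module _ {F G : Frame ℓ} where
  open Category (MKF-all ℓ) using (_≅_)

  ≅⇒bijective : F ≅ G → Σ[ f ∈ FrameHom F G ] IsFrameIsomorphism f
  ≅⇒bijective i = to
    , (λ {x} {y} fx≡fy → trans (sym (isoˡ x)) (trans (cong (FrameHom.to from) fx≡fy) (isoˡ y)))
    , (λ u → FrameHom.to from u , λ { refl → isoʳ u })
    where open _≅_ i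

  bijective⇒≅ : Σ[ f ∈ FrameHom F G ] IsFrameIsomorphism f → F ≅ G
  bijective⇒≅ (f , injective , surjective) = record
    { to   = f
    ; from = record
      { to    = g
      ; forth = λ u R₁ R₁∈S →
          let R₂ , R₂∈S , p = back (g u) R₁ R₁∈S
          in  R₂ , R₂∈S , λ v r →
                let y , s , fy≡v = p v (subst (λ t → R₂ t v) (sym (fg u)) r)
                in  subst (R₁ (g u)) (injective (trans fy≡v (sym (fg v)))) s
      ; back  = λ u R₂ R₂∈S →
          let R₁ , R₁∈S , p = forth (g u) R₂ R₂∈S
          in  R₁ , R₁∈S , λ y r →
                to y , subst (λ t → R₂ t (to y)) (fg u) (p y r) , gf y
      }
    ; isoˡ = gf
    ; isoʳ = fg
    }
    where
    open FrameHom f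

    g : Frame.W G → Frame.W F
    g u = proj₁ (surjective u)

    fg : ∀ u → to (g u) ≡ u
    fg u = proj₂ (surjective u) refl

    gf : ∀ x → g (to x) ≡ x
    gf x = injective (fg (to x))

{-# OPTIONS --safe #-}

-- On the carrier of κ, regarded as an ordinal, take the relations
-- R_α = {(x, y) : α < y} for α < κ.  By regularity, fewer than κ of them have
-- a common lower bound R_γ, whereas the intersection of all κ < κ′ of them is
-- empty although every point has an R_γ-successor.  Dually, on the powerset of
-- κ let ◇ x be ⊤ if x is unbounded and ⊥ otherwise.  A union of fewer than κ
-- bounded sets is bounded, but κ itself is the union of its κ singletons.
-- Additivity transfers along isomorphisms of algebras.  An isomorphism of frames
-- matches relations only at one point at a time, but emptiness of the
-- intersection of the sets {y : α < y} at a single point is enough.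

module Submission where

open import Defs
open import Algebra.Lattice.Bundles using (BooleanAlgebra)
import Algebra.Lattice.Properties.Lattice as LatticeProperties
open import Axiom.ExcludedMiddle using (ExcludedMiddle)
open import Data.Bool.Base using (Bool; true; false; T; _∧_; _∨_; not)
import Data.Bool.Properties as Bool
open import Data.Empty using (⊥-elim)
open import Data.Product.Base using (Σ-syntax; ∃; ∃-syntax; _×_; _,_; proj₁; proj₂)
open import Data.Sum.Base using (_⊎_; inj₁; inj₂; [_,_]′)
open import Data.Unit.Base using (tt)
open import Function.Base using (id; _∘_; const)
open import Function.Bundles using (Injection; Equivalence)
open import Induction.WellFounded using (Acc; acc)
open import Level using (Level; suc; _⊔_; lift; lower)
open import Relation.Binary.Bundles using (Setoid; Poset)
open import Relation.Binary.Core using (Rel; _⇔_)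
open import Relation.Binary.Definitions using (tri<; tri≈; tri>)
open import Relation.Binary.PropositionalEquality
  using (_≡_; refl; sym; trans; cong; cong₂; subst)
import Relation.Binary.Reasoning.Setoid as SetoidReasoning
open import Relation.Binary.Structures using (IsStrictTotalOrder)
open import Relation.Nullary.Decidable
  using (Dec; yes; no; map′; decidable-stable; ⌊_⌋; toWitness; fromWitness)
open import Relation.Nullary.Negation.Core using (¬_; contradiction)
open import Relation.Unary using (Pred; _∈_; _⊆_)

private
  variable
    a b ℓ : Level

-- Least elements and small families

lower-em : ExcludedMiddle (suc ℓ) → ExcludedMiddle ℓ
lower-em {ℓ} em = map′ lower (lift {ℓ = suc ℓ}) em

module _ (em : ExcludedMiddle ℓ) (L : WellOrder ℓ) where
  open WellOrder L

  IsLeast : Pred Carrier ℓ → Pred Carrier ℓ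
  IsLeast P α = P α × (∀ β → P β → ¬ β < α)

  least : (P : Pred Carrier ℓ) → ∃ P → ∃ (IsLeast P)
  least P (α , Pα) = go α Pα (wellFounded α)
    where
    go : ∀ α → P α → Acc _<_ α → ∃ (IsLeast P)
    go α Pα (acc rec) with em {∃[ β ] (P β × β < α)}
    ... | yes (β , Pβ , β<α) = go β Pβ (rec β<α)
    ... | no none            = α , Pα , λ β Pβ β<α → none (β , Pβ , β<α)

  -- Two predicates occur because equal setoid elements have index sets that agree only
  -- extensionally; this is what makes the least index respect setoid equality.
  least-unique : ∀ {P Q α β} → P ⊆ Q → Q ⊆ P → IsLeast P α → IsLeast Q β → α ≡ β
  least-unique {α = α} {β} P⊆Q Q⊆P (Pα , minα) (Qβ , minβ)
    with IsStrictTotalOrder.compare isStrictTotalOrder α β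
  ... | tri< α<β _ _ = contradiction α<β (minβ α (P⊆Q Pα))
  ... | tri≈ _ α≡β _ = α≡β
  ... | tri> _ _ β<α = contradiction β<α (minα β (Q⊆P Qβ))

-- Sending an element to its least index avoids any choice.

family-small : ExcludedMiddle ℓ → (κ κ′ : Cardinal ℓ) → κ <ᶜ κ′ →
               (X : Setoid a ℓ) (P : Pred (Setoid.Carrier X) b)
               (F : Cardinal.Carrier κ → Setoid.Carrier X) →
               (∀ x → x ∈ P → ∃[ α ] Setoid._≈_ X x (F α)) →
               ∣ subset X P ∣< Cardinal.wellOrder κ′
family-small em κ κ′ (α′ , g , g<α′) X P F index = α′ , record
  { to        = λ x → G.to (proj₁ (ix x))
  ; cong      = λ {x} {y} x≈y → G.cong
      (least-unique em K.wellOrder (X.trans (X.sym x≈y)) (X.trans x≈y) (proj₂ (ix x)) (proj₂ (ix y)))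
  ; injective = λ {x} {y} eq → X.trans (proj₁ (proj₂ (ix x)))
      (X.sym (subst (λ α → proj₁ y X.≈ F α) (sym (G.injective eq)) (proj₁ (proj₂ (ix y)))))
  } , λ x → g<α′ (proj₁ (ix x))
  where
  module K = Cardinal κ
  module G = Injection g
  module X = Setoid X

  ix : ((x , _) : ∃ P) → ∃ (IsLeast em K.wellOrder (λ α → x X.≈ F α))
  ix (x , x∈P) = least em K.wellOrder _ (index x x∈P)

-- Consequences of regularity

module RegularCardinal (κ : Cardinal ℓ) (regular : Regular κ) where
  open Cardinal κ
  open Regular regular
  open IsStrictTotalOrder isStrictTotalOrder public
    using (compare) renaming (trans to <-trans; irrefl to <-irrefl)

  point : Carrier
  point = Injection.to infinite 0

  -- Bounding a constant function gives information only over a nonempty initial segment. Two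
  -- distinct values of the injection of `ℕ` supply one: the smaller lies below the larger.
  exceeds : ∀ α → ∃[ β ] α < β
  exceeds α with compare point (Injection.to infinite 1)
  ... | tri< p<q _ _ = let γ , p = bounded _ (const α) in γ , p _ p<q
  ... | tri≈ _ p≡q _ = contradiction (Injection.injective infinite p≡q) λ ()
  ... | tri> _ _ q<p = let γ , p = bounded _ (const α) in γ , p _ q<p

  -- The larger of the two, phrased through initial segments since the order is strict.
  upper₂ : ∀ α β → ∃[ γ ] (∀ {δ} → δ < α → δ < γ) × (∀ {δ} → δ < β → δ < γ)
  upper₂ α β with compare α β
  ... | tri< α<β _ _  = β , (λ δ<α → <-trans δ<α α<β) , id
  ... | tri≈ _ refl _ = α , id , id
  ... | tri> _ _ β<α  = α , id , λ δ<β → <-trans δ<β β<α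

  -- As F need not respect the equality of X, only some representative of each
  -- class is controlled.

  small-bounded : (X : Setoid a b) → ExcludedMiddle (a ⊔ ℓ) →
                  ∣ X ∣< wellOrder → (F : Setoid.Carrier X → Carrier) →
                  ∃[ γ ] (∀ x → ∃[ y ] (Setoid._≈_ X x y × F y < γ))
  small-bounded X em (α , h , h<α) F = γ , covered
    where
    module X = Setoid X
    module H = Injection h

    -- `F` is transported to the ordinal along the partial inverse of `h`. The default `point` is
    -- harmless, as the bound is only evaluated at values of `h`.
    F′ : ∀ β → Dec (∃[ x ] H.to x ≡ β) → Carrier
    F′ β (yes (x , _)) = F x
    F′ β (no _)        = point

    fiber? : ∀ β → Dec (∃[ x ] H.to x ≡ β)
    fiber? _ = em

    γ = proj₁ (bounded α λ β → F′ β (fiber? β))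

    covered : ∀ x → ∃[ y ] (x X.≈ y × F y < γ)
    covered x with fiber? (H.to x) | proj₂ (bounded α λ β → F′ β (fiber? β)) (H.to x) (h<α x)
    ... | yes (y , hy≡hx) | Fy<γ = y , H.injective (sym hy≡hx) , Fy<γ
    ... | no ∄y           | _    = contradiction (x , refl) ∄y

-- The frame of tails

module _ (em : ExcludedMiddle (suc ℓ)) (κ : Cardinal ℓ) (regular : Regular κ) where
  open Cardinal κ
  open RegularCardinal κ regular

  Above : Carrier → Rel Carrier ℓ
  Above α _ y = α < y

  tailFrame : Frame ℓ
  tailFrame = record
    { W          = Carrier
    -- Membership is up to `_⇔_`, since `_≡_` between relations would live in `Set (suc ℓ)`.
    ; S          = λ R → ∃[ α ] R ⇔ Above α
    ; W-nonempty = point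
    ; S-nonempty = Above point , point , id , id
    }

  tailFrame-directed : IsDownwardDirected κ tailFrame
  tailFrame-directed S′ S′⊆S small = Above γ , (γ , id , id) , λ γ<y R R∈S′ →
    -- `γ` bounds the index of some equivalent `Q`, not necessarily the one recorded for `R`.
    let (Q , Q∈S′) , (_ , Q⇒R) , α<γ = below (R , R∈S′)
        _ , _ , Above⇒Q = S′⊆S Q∈S′
    in  Q⇒R (Above⇒Q (<-trans α<γ γ<y))
    where
    bound = small-bounded (subset (relations Carrier) S′) em small
              (λ (R , R∈S′) → proj₁ (S′⊆S R∈S′))
    γ     = proj₁ bound
    below = proj₂ bound

  -- Every tail is pulled back along `forth` at one point of `G`. A relation below all the pullbacks
  -- has, by `back`, a successor there, whose image would have to exceed every element of `κ`,
  -- itself included.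
  tailFrame-not-directed : (κ′ : Cardinal ℓ) → κ <ᶜ κ′ →
                           (G : Frame ℓ) → IsDownwardDirected κ′ G →
                           ¬ Category._≅_ (MKF-all ℓ) G tailFrame
  tailFrame-not-directed κ′ κ<κ′ G directed i =
    let x                    = G.W-nonempty
        R , R∈S , R⇒⋂        = directed S′ proj₁ S′-small
        Q , (β , _ , β⇒Q) , back = f.back x R R∈S
        y , β<y              = exceeds β
        z , Rxz , fz≡y       = back y (β⇒Q β<y)
    in  <-irrefl refl (preimage-sound (f.to z) z (R⇒⋂ Rxz _ (preimage∈S′ (f.to z))))
    where
    module G = Frame G
    module f = FrameHom (Category._≅_.to i)

    forth : ∀ α → ∃[ R ] (R ∈ G.S × (∀ y → R G.W-nonempty y → α < f.to y))
    forth α = f.forth G.W-nonempty (Above α) (α , id , id)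

    -- Not a full inverse image: only the successors of `G.W-nonempty` are controlled.
    preimage : Carrier → Rel G.W ℓ
    preimage α = proj₁ (forth α)

    preimage-sound : ∀ α y → preimage α G.W-nonempty y → α < f.to y
    preimage-sound α = proj₂ (proj₂ (forth α))

    -- The first conjunct is carried along because `G.S` need not be closed under `_⇔_`.
    S′ : Pred (Rel G.W ℓ) ℓ
    S′ R = R ∈ G.S × ∃[ α ] R ⇔ preimage α

    preimage∈S′ : ∀ α → preimage α ∈ S′
    preimage∈S′ α = proj₁ (proj₂ (forth α)) , α , id , id

    S′-small : ∣ subset (relations G.W) S′ ∣< Cardinal.wellOrder κ′
    S′-small = family-small (lower-em em) κ κ′ κ<κ′ (relations G.W) S′ preimage
                 λ _ → proj₂

-- Transfer of additivity along isomorphisms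

module _ {A B : CompleteAtomicModalAlgebra ℓ} where
  private
    module A = CompleteAtomicModalAlgebra A
    module B = CompleteAtomicModalAlgebra B
    module E = Setoid A.setoid
    module EB = Setoid B.setoid

  IsAdditive-resp-≅ : (κ : Cardinal ℓ) → Category._≅_ (CAMA-all ℓ) B A →
                      IsAdditive κ B → IsAdditive κ A
  IsAdditive-resp-≅ κ i additive X (α , h , h<α) = begin
    A.◇ (A.⋁ X)                       ≈⟨ A.◇-cong (isoʳ (A.⋁ X)) ⟨
    A.◇ (f.to (g.to (A.⋁ X)))         ≈⟨ f.◇-homo _ ⟨
    f.to (B.◇ (g.to (A.⋁ X)))         ≈⟨ f.⟦⟧-cong (B.◇-cong (g.⋁-homo X)) ⟩
    f.to (B.◇ (B.⋁ Y))                ≈⟨ f.⟦⟧-cong (additive Y Y-small) ⟩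
    f.to (B.⋁ (image B.setoid B.◇ Y)) ≈⟨ f.⋁-homo _ ⟩
    A.⋁ (image A.setoid f.to (image B.setoid B.◇ Y))
                                      ≈⟨ ⋁-resp A
      (λ { z (_ , (_ , (x , x∈X , y≈gx) , w≈◇y) , z≈fw) →
             z , (x , x∈X , E.trans z≈fw (E.trans (f.⟦⟧-cong w≈◇y) (f◇≈◇ x y≈gx))) , E.refl })
      (λ { z (x , x∈X , z≈◇x) →
             f.to (B.◇ (g.to x))
           , (_ , (g.to x , (x , x∈X , EB.refl) , EB.refl) , E.refl)
           , E.trans z≈◇x (E.sym (f◇≈◇ x EB.refl)) }) ⟩
    A.⋁ (image A.setoid A.◇ X)        ∎
    where
    open SetoidReasoning A.setoid
    open Category._≅_ i
    module f = AlgebraHom to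
    module g = AlgebraHom from
    module H = Injection h

    Y : Pred B.Carrier ℓ
    Y = image B.setoid g.to X

    f◇≈◇ : ∀ {y} x → y B.≈ g.to x → f.to (B.◇ y) A.≈ A.◇ x
    f◇≈◇ x y≈gx = E.trans (f.◇-homo _)
      (A.◇-cong (E.trans (f.⟦⟧-cong y≈gx) (isoʳ x)))

    g-injective : ∀ {x y} → g.to x B.≈ g.to y → x A.≈ y
    g-injective {x} {y} gx≈gy =
      E.trans (E.sym (isoʳ x)) (E.trans (f.⟦⟧-cong gx≈gy) (isoʳ y))

    -- An element of `Y` is counted by the element of `X` stored in its membership proof;
    -- injectivity of `g.to` makes the count independent of that proof.
    Y-small : ∣ subset B.setoid Y ∣< Cardinal.wellOrder κ
    Y-small = α , record
      { to        = λ (_ , x , x∈X , _) → H.to (x , x∈X)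
      ; cong      = λ { {_ , _ , _ , y≈gx} {_ , _ , _ , y′≈gx′} y≈y′ → H.cong
          (g-injective (EB.trans (EB.sym y≈gx) (EB.trans y≈y′ y′≈gx′))) }
      ; injective = λ { {_ , _ , _ , y≈gx} {_ , _ , _ , y′≈gx′} eq →
          EB.trans y≈gx (EB.trans (g.⟦⟧-cong (H.injective eq)) (EB.sym y′≈gx′)) }
      } , λ (_ , x , x∈X , _) → h<α (x , x∈X)

-- Powersets as complete atomic Boolean algebras

module Powerset (em : ExcludedMiddle ℓ) (I : Set ℓ) where

  infix 4 _⊑_
  _⊑_ : Rel (I → Bool) ℓ
  x ⊑ y = ∀ i → T (x i) → T (y i)

  ⊑-antisym : ∀ {x y} → x ⊑ y → y ⊑ x → ∀ i → x i ≡ y i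
  ⊑-antisym {x} {y} x⊑y y⊑x i with x i | y i | x⊑y i | y⊑x i
  ... | true  | true  | _ | _ = refl
  ... | true  | false | p | _ = ⊥-elim (p tt)
  ... | false | true  | _ | q = ⊥-elim (q tt)
  ... | false | false | _ | _ = refl

  -- Subsets are Boolean-valued so that the carrier stays in `Set ℓ`; excluded middle turns each
  -- predicate into such a function.
  booleanAlgebra : BooleanAlgebra ℓ ℓ
  booleanAlgebra = record
    { Carrier = I → Bool
    ; _≈_     = λ x y → ∀ i → x i ≡ y i
    ; _∨_     = λ x y i → x i ∨ y i
    ; _∧_     = λ x y i → x i ∧ y i
    ; ¬_      = λ x i → not (x i)
    ; ⊤       = λ _ → true
    ; ⊥       = λ _ → false
    ; isBooleanAlgebra = record
      { isDistributiveLattice = record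
        { isLattice = record
          { isEquivalence = record
            { refl  = λ _ → refl
            ; sym   = λ p i → sym (p i)
            ; trans = λ p q i → trans (p i) (q i)
            }
          ; ∨-comm     = λ x y i → Bool.∨-comm (x i) (y i)
          ; ∨-assoc    = λ x y z i → Bool.∨-assoc (x i) (y i) (z i)
          ; ∨-cong     = λ p q i → cong₂ _∨_ (p i) (q i)
          ; ∧-comm     = λ x y i → Bool.∧-comm (x i) (y i)
          ; ∧-assoc    = λ x y z i → Bool.∧-assoc (x i) (y i) (z i)
          ; ∧-cong     = λ p q i → cong₂ _∧_ (p i) (q i)
          ; absorptive = (λ x y i → proj₁ Bool.∨-∧-absorptive (x i) (y i))
                       , (λ x y i → proj₂ Bool.∨-∧-absorptive (x i) (y i))
          }
        ; ∨-distrib-∧ = (λ x y z i → proj₁ Bool.∨-distrib-∧ (x i) (y i) (z i))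
                      , (λ x y z i → proj₂ Bool.∨-distrib-∧ (x i) (y i) (z i))
        ; ∧-distrib-∨ = (λ x y z i → proj₁ Bool.∧-distrib-∨ (x i) (y i) (z i))
                      , (λ x y z i → proj₂ Bool.∧-distrib-∨ (x i) (y i) (z i))
        }
      ; ∨-complement = (λ x i → proj₁ Bool.∨-inverse (x i))
                     , (λ x i → proj₂ Bool.∨-inverse (x i))
      ; ∧-complement = (λ x i → proj₁ Bool.∧-inverse (x i))
                     , (λ x i → proj₂ Bool.∧-inverse (x i))
      ; ¬-cong       = λ p i → cong not (p i)
      }
    }

  open BooleanAlgebra booleanAlgebra using (Carrier; _≈_; ⊥; lattice)
  open Poset (LatticeProperties.poset lattice) using (_≤_)

  -- The lattice order is an equation with a meet; this and its converse trade it for inclusion.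
  ≤⇒⊑ : ∀ {x y} → x ≤ y → x ⊑ y
  ≤⇒⊑ {x} {y} x≤y i with x i | y i | x≤y i
  ... | true  | true  | _ = id
  ... | false | _     | _ = λ ()

  ⊑⇒≤ : ∀ {x y} → x ⊑ y → x ≤ y
  ⊑⇒≤ {x} {y} x⊑y i with x i | y i | x⊑y i
  ... | true  | true  | _ = refl
  ... | true  | false | p = ⊥-elim (p tt)
  ... | false | _     | _ = refl

  -- Opaque, so that P can be inferred from T (⟪ P ⟫ i).
  opaque
    ⟪_⟫ : Pred I ℓ → Carrier
    ⟪ P ⟫ i = ⌊ em {P i} ⌋

    ∈⟪⟫⁺ : ∀ {P i} → P i → T (⟪ P ⟫ i)
    ∈⟪⟫⁺ = fromWitness

    ∈⟪⟫⁻ : ∀ {P i} → T (⟪ P ⟫ i) → P i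
    ∈⟪⟫⁻ = toWitness

  ⋃ ⋂′ : Pred Carrier ℓ → Carrier
  ⋃  X = ⟪ (λ i → ∃[ x ] (x ∈ X × T (x i))) ⟫
  ⋂′ X = ⟪ (λ i → ∀ x → x ∈ X → T (x i)) ⟫

  ⋃-join : ∀ X → IsJoin booleanAlgebra X (⋃ X)
  ⋃-join X =
      (λ x x∈X → ⊑⇒≤ λ i i∈x → ∈⟪⟫⁺ (x , x∈X , i∈x))
    , (λ u ub → ⊑⇒≤ {⋃ X} {u} λ i i∈⋃ → let x , x∈X , i∈x = ∈⟪⟫⁻ i∈⋃ in ≤⇒⊑ (ub x x∈X) i i∈x)

  ⋂-meet : ∀ X → IsMeet booleanAlgebra X (⋂′ X)
  ⋂-meet X =
      (λ x x∈X → ⊑⇒≤ λ i i∈⋂ → ∈⟪⟫⁻ i∈⋂ x x∈X)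
    , (λ l lb → ⊑⇒≤ λ i i∈l → ∈⟪⟫⁺ λ x x∈X → ≤⇒⊑ (lb x x∈X) i i∈l)

  singleton : I → Carrier
  singleton i = ⟪ (i ≡_) ⟫

  singleton-atom : ∀ i → IsAtom booleanAlgebra (singleton i)
  singleton-atom i = (λ eq → subst T (eq i) (∈⟪⟫⁺ refl)) , below
    where
    below : ∀ x → x ≤ singleton i → x ≈ ⊥ ⊎ x ≈ singleton i
    below x x≤i with em {∃[ j ] T (x j)}
    ... | no empty = inj₁ (⊑-antisym (λ j j∈x → ⊥-elim (empty (j , j∈x))) λ _ ())
    ... | yes (j , j∈x) with ∈⟪⟫⁻ (≤⇒⊑ x≤i j j∈x)
    ...   | refl = inj₂ (⊑-antisym (≤⇒⊑ x≤i) λ k k∈i → subst (T ∘ x) (∈⟪⟫⁻ k∈i) j∈x)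

  atomic : IsAtomic booleanAlgebra
  atomic x x≉⊥ with em {∃[ i ] T (x i)}
  ... | yes (i , i∈x) = singleton i , singleton-atom i ,
          ⊑⇒≤ λ j j∈i → subst (T ∘ x) (∈⟪⟫⁻ j∈i) i∈x
  ... | no empty      = contradiction (⊑-antisym (λ i i∈x → ⊥-elim (empty (i , i∈x))) (λ _ ())) x≉⊥

-- The modal algebra of unbounded sets

module _ (em : ExcludedMiddle ℓ) (κ : Cardinal ℓ) (regular : Regular κ) where
  open Cardinal κ using (Carrier; _<_)
  open RegularCardinal κ regular
  open Powerset em Carrier

  Bounded : Pred (Carrier → Bool) ℓ
  Bounded x = ∃[ γ ] (∀ δ → T (x δ) → δ < γ)

  Bounded-⊑ : ∀ {x y} → x ⊑ y → Bounded y → Bounded x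
  Bounded-⊑ x⊑y (γ , bound) = γ , λ δ → bound δ ∘ x⊑y δ

  -- With `Bounded-⊑` this makes the bounded sets an ideal, which is why `◇` preserves binary joins.
  Bounded-∨ : ∀ {x y} → Bounded x → Bounded y → Bounded (λ δ → x δ ∨ y δ)
  Bounded-∨ (α , x<α) (β , y<β) = let γ , α⊆γ , β⊆γ = upper₂ α β in
    γ , λ δ → [ α⊆γ ∘ x<α δ , β⊆γ ∘ y<β δ ]′ ∘ Equivalence.to Bool.T-∨

  unbounded : (Carrier → Bool) → Carrier → Bool
  unbounded x = ⟪ (λ _ → ¬ Bounded x) ⟫

  unbounded-⊑ : ∀ {x y} → x ⊑ y → unbounded x ⊑ unbounded y
  unbounded-⊑ x⊑y _ p = ∈⟪⟫⁺ (∈⟪⟫⁻ p ∘ Bounded-⊑ x⊑y)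

  tailAlgebra : CompleteAtomicModalAlgebra ℓ
  tailAlgebra = record
    { booleanAlgebra = booleanAlgebra
    ; ⋁      = ⋃
    ; ⋀      = ⋂′
    ; ⋁-join = ⋃-join
    ; ⋀-meet = ⋂-meet
    ; atomic = atomic
    ; ◇      = unbounded
    ; ◇-cong = λ x≈y → ⊑-antisym
        (unbounded-⊑ λ i → subst T (x≈y i))
        (unbounded-⊑ λ i → subst T (sym (x≈y i)))
    ; ◇-⊥    = ⊑-antisym (λ _ p → contradiction (point , λ _ ()) (∈⟪⟫⁻ p)) λ _ ()
    ; ◇-∨    = λ x y → ⊑-antisym
        (λ i p → Equivalence.from Bool.T-∨ (split i (∈⟪⟫⁻ p)))
        (λ i → [ unbounded-⊑ {x} (λ j → Equivalence.from (Bool.T-∨ {x j}) ∘ inj₁) i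
               , unbounded-⊑ {y} (λ j → Equivalence.from (Bool.T-∨ {x j}) ∘ inj₂) i ]′
               ∘ Equivalence.to (Bool.T-∨ {unbounded x i}))
    }
    where
    split : ∀ {x y} i → ¬ Bounded (λ δ → x δ ∨ y δ) → T (unbounded x i) ⊎ T (unbounded y i)
    split {x} i ¬x∨y with em {Bounded x}
    ... | yes bx = inj₂ (∈⟪⟫⁺ (¬x∨y ∘ Bounded-∨ bx))
    ... | no ¬bx = inj₁ (∈⟪⟫⁺ ¬bx)

  open CompleteAtomicModalAlgebra tailAlgebra using (setoid)

  Bounded-⋃ : (X : Pred (Carrier → Bool) ℓ) →
              ∣ subset setoid X ∣< Cardinal.wellOrder κ →
              (∀ x → x ∈ X → Bounded x) → Bounded (⋃ X)
  Bounded-⋃ X small bounded = γ , λ δ δ∈⋃ →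
    let x , x∈X , δ∈x = ∈⟪⟫⁻ δ∈⋃
        -- Only the bound chosen for some `y` equal to `x` is known to lie below `γ`, so `δ` is
        -- moved from `x` to `y`.
        (y , y∈X) , x≈y , β<γ = below (x , x∈X)
    in  <-trans (proj₂ (bounded y y∈X) δ (subst T (x≈y δ) δ∈x)) β<γ
    where
    bound = small-bounded (subset setoid X) em small
              (λ (x , x∈X) → proj₁ (bounded x x∈X))
    γ     = proj₁ bound
    below = proj₂ bound

  tailAlgebra-additive : IsAdditive κ tailAlgebra
  tailAlgebra-additive X small = ⊑-antisym
    -- If no `◇ x` with `x ∈ X` contained `i`, every such `x` would be bounded, and so would their
    -- union.
    (λ i p → decidable-stable (Bool.T? _) λ none → ∈⟪⟫⁻ p (Bounded-⋃ X small λ x x∈X →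
      decidable-stable em λ ¬bx → none (∈⟪⟫⁺ (unbounded x , (x , x∈X , λ _ → refl) , ∈⟪⟫⁺ ¬bx))))
    -- This inclusion is monotonicity of `◇`.
    (λ i p → let z , (x , x∈X , z≈◇x) , i∈z = ∈⟪⟫⁻ p in
      unbounded-⊑ (≤⇒⊑ (proj₁ (⋃-join X) x x∈X)) i (subst T (z≈◇x i) i∈z))

  singleton-bounded : ∀ α → Bounded (singleton α)
  singleton-bounded α = let β , α<β = exceeds α in
    β , λ δ δ∈α → subst (_< β) (∈⟪⟫⁻ δ∈α) α<β

  -- Additivity would put `point` into `◇` of a single singleton, which is bounded.
  tailAlgebra-not-additive : (κ′ : Cardinal ℓ) → κ <ᶜ κ′ → ¬ IsAdditive κ′ tailAlgebra
  tailAlgebra-not-additive κ′ κ<κ′ additive =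
    let _ , (x , (α , x≈α) , z≈◇x) , p∈z =
          ∈⟪⟫⁻ (subst T (additive X X-small point) (∈⟪⟫⁺ ⋃-unbounded))
    in  ∈⟪⟫⁻ (subst T (z≈◇x point) p∈z)
          (Bounded-⊑ (λ i → subst T (x≈α i)) (singleton-bounded α))
    where
    X : Pred (Carrier → Bool) ℓ
    X x = ∃[ α ] (∀ i → x i ≡ singleton α i)

    X-small : ∣ subset setoid X ∣< Cardinal.wellOrder κ′
    X-small = family-small em κ κ′ κ<κ′ setoid X singleton λ _ → id

    ⋃-unbounded : ¬ Bounded (⋃ X)
    -- A bound `γ` would have to exceed itself, since its own singleton belongs to `X`.
    ⋃-unbounded (γ , bound) = <-irrefl refl
      (bound γ (∈⟪⟫⁺ (singleton γ , (γ , λ _ → refl) , ∈⟪⟫⁺ refl)))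

theorem10p2 : ∀ {ℓ : Level} → ExcludedMiddle (suc ℓ) →
    (κ κ′ : Cardinal ℓ) → Regular κ → Regular κ′ → (κ<κ′ : κ <ᶜ κ′) →
    ( ¬ EssentiallySurjective (CAMA-inclusion κ κ′ κ<κ′)
    × (Σ[ A ∈ Category.Obj (CAMA κ) ] (∀ (B : Category.Obj (CAMA κ′)) →
    ¬ Category._≅_ (CAMA κ) (Functor.F₀ (CAMA-inclusion κ κ′ κ<κ′) B) A)) )
    ×
    ( ¬ EssentiallySurjective (MKF-inclusion κ κ′ κ<κ′)
    × (Σ[ F ∈ Category.Obj (MKF κ) ] (∀ (G : Category.Obj (MKF κ′)) →
    ¬ Category._≅_ (MKF κ) (Functor.F₀ (MKF-inclusion κ κ′ κ<κ′) G) F)) )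
theorem10p2 {ℓ} em κ κ′ regular _ κ<κ′ =
    ((λ surjective → let B , i = surjective A in A-new B i) , A , A-new)
  , ((λ surjective → let G , i = surjective F in F-new G i) , F , F-new)
  where
  em₀ : ExcludedMiddle ℓ
  em₀ = lower-em em

  A : Category.Obj (CAMA κ)
  A = tailAlgebra em₀ κ regular , tailAlgebra-additive em₀ κ regular

  A-new : ∀ B → ¬ Category._≅_ (CAMA κ) (Functor.F₀ (CAMA-inclusion κ κ′ κ<κ′) B) A
  A-new (B , additive) i = tailAlgebra-not-additive em₀ κ regular κ′ κ<κ′
    -- The isomorphism is repacked from the full subcategory into the ambient category, with the
    -- same data.
    (IsAdditive-resp-≅ κ′ record { to = to ; from = from ; isoˡ = isoˡ ; isoʳ = isoʳ } additive)
    where open Category._≅_ i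

  F : Category.Obj (MKF κ)
  F = tailFrame em κ regular , tailFrame-directed em κ regular

  F-new : ∀ G → ¬ Category._≅_ (MKF κ) (Functor.F₀ (MKF-inclusion κ κ′ κ<κ′) G) F
  F-new (G , directed) i = tailFrame-not-directed em κ regular κ′ κ<κ′ G directed
    record { to = to ; from = from ; isoˡ = isoˡ ; isoʳ = isoʳ }
    where open Category._≅_ i
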